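{- Let $G^\sigma$ be a connected oriented graph of order $n\geq 5$. Then $sr(G^\sigma)=2$ if and only if the underlying graph of $G^\sigma$ is a complete bipartite graph or a complete tripartite graph and every cycle of length $4$ in $G^\sigma$ is evenly-oriented.
   Context: An oriented graph $G^\sigma$ is a simple graph $G$ (underlying graph) together with an orientation of each edge. Its skew-adjacency matrix $S(G^\sigma)=(s_{ij})$ has $s_{ij}=1$ if there is an arc from $v_i$ to $v_j$, $s_{ij}=-1$ if there is an arc from $v_j$ to $v_i$, and $0$ otherwise; the skew-rank $sr(G^\sigma)$ is the rank of $S(G^\sigma)$. For an even cycle $u_1\cdots u_ku_1$, its sign is the sign of $\prod_{i=1}^k s_{u_iu_{i+1}}$ ($u_{k+1}=u_1$); the cycle is evenly-oriented if this sign is positive and oddly-oriented if negative. -}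

module Defs where

open import Data.Bool.Base using (if_then_else_)
open import Data.Fin.Base using (Fin; toℕ)
open import Data.Nat.Base using (ℕ; suc; _≤_)
open import Data.Nat.DivMod using (_mod_)
open import Data.Product.Base using (_×_; ∃-syntax)
open import Data.Rational.Base as ℚ using (ℚ; 0ℚ; 1ℚ)
open import Data.Rational.Properties using (+-0-commutativeMonoid; *-1-commutativeMonoid)
open import Data.Sum.Base using (_⊎_)
open import Data.Vec.Functional using (Vector; transpose)
open import Function.Bundles using (_⇔_)
open import Function.Definitions using (Injective; Surjective)
open import Level using (0ℓ)
open import Relation.Binary.Core using (Rel)
open import Relation.Binary.Construct.Closure.ReflexiveTransitive using (Star)
open import Relation.Binary.Definitions using (Asymmetric; Decidable; Irreflexive; Symmetric)
open import Relation.Binary.PropositionalEquality.Core using (_≡_; _≢_; _≗_)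
open import Relation.Nullary.Decidable.Core using (does)

open import Algebra.Properties.CommutativeMonoid.Sum +-0-commutativeMonoid
  using () renaming (sum to ∑)
open import Algebra.Properties.CommutativeMonoid.Sum *-1-commutativeMonoid
  using () renaming (sum to ∏)

-- The skew-adjacency matrix has entries in {-1, 0, 1}, so its rank over ℝ is
-- the same as its rank over ℚ.

linearCombination : ∀ {m r} → Vector ℚ r → Vector (Vector ℚ m) r → Vector ℚ m
linearCombination c b i = ∑ (λ j → c j ℚ.* b j i)

LinearlyIndependent : ∀ {m r} → Vector (Vector ℚ m) r → Set
LinearlyIndependent b =
  ∀ c → linearCombination c b ≗ (λ _ → 0ℚ) → c ≗ (λ _ → 0ℚ)

InSpan : ∀ {m r} → Vector (Vector ℚ m) r → Vector ℚ m → Set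
InSpan b v = ∃[ c ] v ≗ linearCombination c b

-- An m × n matrix is given by its rows.
Matrix : ℕ → ℕ → Set
Matrix m n = Vector (Vector ℚ n) m

-- "rank M = r": the column space of M has a basis of r vectors.
HasRank : ∀ {m n} → Matrix m n → ℕ → Set
HasRank {m} M r = ∃[ b ]
  LinearlyIndependent {m} {r} b × (∀ v → InSpan (transpose M) v ⇔ InSpan b v)

record SimpleGraph (n : ℕ) : Set₁ where
  field
    Adj    : Rel (Fin n) 0ℓ
    adj?   : Decidable Adj
    sym    : Symmetric Adj
    irrefl : Irreflexive _≡_ Adj

record OrientedGraph (n : ℕ) : Set₁ where
  field
    underlying : SimpleGraph n

  open SimpleGraph underlying public

  field
    Arc     : Rel (Fin n) 0ℓ
    arc?    : Decidable Arc
    arc⇒adj : ∀ {u v} → Arc u v → Adj u v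
    adj⇒arc : ∀ {u v} → Adj u v → Arc u v ⊎ Arc v u
    asym    : Asymmetric Arc

module _ {n : ℕ} (G : SimpleGraph n) where
  open SimpleGraph G

  Connected : Set
  Connected = ∀ u v → Star Adj u v

  -- Surjectivity of part says that all k parts are nonempty.
  CompleteMultipartite : ℕ → Set
  CompleteMultipartite k = ∃[ part ]
    Surjective {A = Fin n} {B = Fin k} _≡_ _≡_ part ×
    (∀ u v → Adj u v ⇔ part u ≢ part v)

  CompleteBipartite : Set
  CompleteBipartite = CompleteMultipartite 2

  CompleteTripartite : Set
  CompleteTripartite = CompleteMultipartite 3

-- i ↦ i + 1 modulo k
next : ∀ {k} → Fin k → Fin k
next {suc k} i = suc (toℕ i) mod suc k

record Cycle {n : ℕ} (G : SimpleGraph n) (k : ℕ) : Set where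
  open SimpleGraph G
  field
    3≤k       : 3 ≤ k
    vertex    : Vector (Fin n) k
    injective : Injective _≡_ _≡_ vertex
    adjacent  : ∀ i → Adj (vertex i) (vertex (next i))

module _ {n : ℕ} (G : OrientedGraph n) where
  open OrientedGraph G

  skewAdjacency : Matrix n n
  skewAdjacency u v =
    if does (arc? u v) then 1ℚ
    else if does (arc? v u) then ℚ.- 1ℚ
    else 0ℚ

  HasSkewRank : ℕ → Set
  HasSkewRank = HasRank skewAdjacency

  -- Independent of the direction of traversal only for even k, the case in
  -- which the notion is meaningful.
  EvenlyOriented : ∀ {k} → Cycle underlying k → Set
  EvenlyOriented C =
    0ℚ ℚ.< ∏ (λ i → skewAdjacency (vertex i) (vertex (next i)))
    where open Cycle C

open OrientedGraph public using (underlying)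

{-# OPTIONS --safe #-}
module Submission where

-- A skew-symmetric matrix has rank at most 2 exactly when its 4 × 4 principal
-- Pfaffians s_ab s_cd − s_ac s_bd + s_ad s_bc vanish; one implication holds
-- because the Pfaffian times s_ab is a 3 × 3 minor, the other because the
-- vanishing of those with s_ab ≠ 0 writes every column as a combination of
-- columns a and b.  With entries in {-1, 0, 1}, vanishing forbids K₄ (a sum of
-- three signs is odd), makes non-adjacency transitive, and on a 4-cycle abcd
-- gives s_ab s_cd = s_bc s_da, so the cycle is even.  Conversely, with at most
-- three parts two of any four vertices share a part, and the Pfaffian vanishes
-- since the rows of such a pair are proportional on any two columns, by
-- evenness of the 4-cycle these span.

open import Defs
open import Data.Fin.Base using (Fin; zero; suc; punchIn)
open import Data.Fin.Properties using (_≟_; any?; pigeonhole; punchInᵢ≢i)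
open import Data.Nat.Base as ℕ using (ℕ; zero; suc; _≥_; z≤n; s≤s; s<s)
open import Data.Product.Base using (_×_; _,_; proj₁; proj₂; ∃-syntax)
open import Data.Rational.Base using (ℚ; 0ℚ; 1ℚ; _+_; _*_; _-_; -_; _<_; *<*)
open import Data.Rational.Properties
  using (+-*-commutativeRing; +-0-commutativeMonoid; *-assoc; *-comm; *-identityˡ;
         *-zeroˡ; *-zeroʳ; _<?_)
open import Data.Rational.Solver using (module +-*-Solver)
open import Data.Sum.Base using (_⊎_; inj₁; inj₂; [_,_]′)
open import Data.Vec.Base using ([]; _∷_; lookup)
open import Data.Vec.Functional as Vector using (Vector; transpose)
open import Data.Vec.Relation.Unary.All using ([]; _∷_)
open import Data.Vec.Relation.Unary.AllPairs using ([]; _∷_)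
open import Data.Vec.Relation.Unary.Unique.Propositional.Properties using (lookup-injective)
open import Algebra.Bundles using (CommutativeRing)
open import Algebra.Properties.CommutativeMonoid.Sum +-0-commutativeMonoid
  using (∑-comm; sum-cong-≗) renaming (sum to ∑)
open import Algebra.Properties.Semiring.Sum (CommutativeRing.semiring +-*-commutativeRing)
  using (*-distribˡ-sum; *-distribʳ-sum)
open import Function.Base using (_∘_)
open import Function.Bundles using (_⇔_; mk⇔; Equivalence)
open import Relation.Binary.Construct.Closure.ReflexiveTransitive using (ε; _◅_)
open import Relation.Binary.PropositionalEquality
open import Relation.Nullary using (¬_; yes; no; contradiction)
open import Relation.Nullary.Decidable using (toWitness; decidable-stable; _×-dec_)

open +-*-Solver using (solve; _:+_; _:*_; _:-_; :-_; con; _:=_)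
open ≡-Reasoning

-- Spans of finite families of vectors

linearCombination-zero : ∀ {m r} (b : Vector (Vector ℚ m) r) →
  linearCombination (λ _ → 0ℚ) b ≗ (λ _ → 0ℚ)
linearCombination-zero {r = zero}  b i = refl
linearCombination-zero {r = suc r} b i =
  cong₂ _+_ (*-zeroˡ (b zero i)) (linearCombination-zero (b ∘ suc) i)

generator∈span : ∀ {m r} (b : Vector (Vector ℚ m) r) j → InSpan b (b j)
generator∈span b zero = (1ℚ Vector.∷ λ _ → 0ℚ) , λ i → sym (begin
  1ℚ * b zero i + linearCombination (λ _ → 0ℚ) (b ∘ suc) i
    ≡⟨ cong (1ℚ * b zero i +_) (linearCombination-zero (b ∘ suc) i) ⟩
  1ℚ * b zero i + 0ℚ
    ≡⟨ solve 1 (λ x → con 1ℚ :* x :+ con 0ℚ := x) refl (b zero i) ⟩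
  b zero i ∎)
generator∈span b (suc j) with generator∈span (b ∘ suc) j
... | c , eq = (0ℚ Vector.∷ c) , λ i → trans (eq i)
  (solve 2 (λ x y → y := con 0ℚ :* x :+ y) refl (b zero i) (linearCombination c (b ∘ suc) i))

span-mono : ∀ {m r s} {a : Vector (Vector ℚ m) r} {b : Vector (Vector ℚ m) s} →
  (∀ j → InSpan b (a j)) → ∀ {v} → InSpan a v → InSpan b v
-- Row `j` of `e` expresses `a j` through `b`, so the new coefficients are the row vector `c` times
-- the matrix `e`. The rest is an exchange of two finite sums.
span-mono {a = a} {b} a⊆b {v} (c , v≗) = (λ k → ∑ λ j → c j * e j k) , λ i → begin
  v i                                        ≡⟨ v≗ i ⟩
  ∑ (λ j → c j * a j i)                      ≡⟨ sum-cong-≗ (λ j → cong (c j *_) (proj₂ (a⊆b j) i)) ⟩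
  ∑ (λ j → c j * ∑ (λ k → e j k * b k i))    ≡⟨ sum-cong-≗ (λ j → *-distribˡ-sum (c j) (λ k → e j k * b k i)) ⟩
  ∑ (λ j → ∑ (λ k → c j * (e j k * b k i)))  ≡⟨ ∑-comm (λ j k → c j * (e j k * b k i)) ⟩
  ∑ (λ k → ∑ (λ j → c j * (e j k * b k i)))  ≡⟨ sum-cong-≗ (λ k → sum-cong-≗ λ j → sym (*-assoc (c j) (e j k) (b k i))) ⟩
  ∑ (λ k → ∑ (λ j → c j * e j k * b k i))    ≡⟨ sum-cong-≗ (λ k → sym (*-distribʳ-sum (b k i) (λ j → c j * e j k))) ⟩
  ∑ (λ k → ∑ (λ j → c j * e j k) * b k i)    ∎
  where
  e : ∀ j k → ℚ
  e j = proj₁ (a⊆b j)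

-- Arithmetic of signs

IsSign : ℚ → Set
IsSign p = p ≡ 1ℚ ⊎ p ≡ - 1ℚ

sign-* : ∀ {p q} → IsSign p → IsSign q → IsSign (p * q)
sign-* (inj₁ refl) (inj₁ refl) = inj₁ refl
sign-* (inj₁ refl) (inj₂ refl) = inj₂ refl
sign-* (inj₂ refl) (inj₁ refl) = inj₂ refl
sign-* (inj₂ refl) (inj₂ refl) = inj₁ refl

sign≢0 : ∀ {p} → IsSign p → p ≢ 0ℚ
sign≢0 (inj₁ refl) ()
sign≢0 (inj₂ refl) ()

sign-square : ∀ {p} → IsSign p → p * p ≡ 1ℚ
sign-square (inj₁ refl) = refl
sign-square (inj₂ refl) = refl

-- A sign is its own inverse, so multiplying by `p` once more recovers `q`.
sign-cancelˡ : ∀ {p} → IsSign p → ∀ q → p * q ≡ 0ℚ → q ≡ 0ℚ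
sign-cancelˡ {p} ±p q pq≡0 = begin
  q            ≡⟨ sym (*-identityˡ q) ⟩
  1ℚ * q       ≡⟨ cong (_* q) (sym (sign-square ±p)) ⟩
  p * p * q    ≡⟨ *-assoc p p q ⟩
  p * (p * q)  ≡⟨ cong (p *_) pq≡0 ⟩
  p * 0ℚ       ≡⟨ *-zeroʳ p ⟩
  0ℚ           ∎

signs-agree : ∀ {p q} → IsSign p → IsSign q → 0ℚ < p * q → p ≡ q
signs-agree (inj₁ refl) (inj₁ refl) _ = refl
signs-agree (inj₁ refl) (inj₂ refl) (*<* ())
signs-agree (inj₂ refl) (inj₁ refl) (*<* ())
signs-agree (inj₂ refl) (inj₂ refl) _ = refl

-- A sum of three odd integers is odd.
sum-of-three-signs≢0 : ∀ {p q r} → IsSign p → IsSign q → IsSign r → p - q + r ≢ 0ℚ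
sum-of-three-signs≢0 (inj₁ refl) (inj₁ refl) (inj₁ refl) ()
sum-of-three-signs≢0 (inj₁ refl) (inj₁ refl) (inj₂ refl) ()
sum-of-three-signs≢0 (inj₁ refl) (inj₂ refl) (inj₁ refl) ()
sum-of-three-signs≢0 (inj₁ refl) (inj₂ refl) (inj₂ refl) ()
sum-of-three-signs≢0 (inj₂ refl) (inj₁ refl) (inj₁ refl) ()
sum-of-three-signs≢0 (inj₂ refl) (inj₁ refl) (inj₂ refl) ()
sum-of-three-signs≢0 (inj₂ refl) (inj₂ refl) (inj₁ refl) ()
sum-of-three-signs≢0 (inj₂ refl) (inj₂ refl) (inj₂ refl) ()

-- Minors of order three and rank two

minor : ∀ {m n} → Matrix m n → (i j k : Fin m) (i′ j′ k′ : Fin n) → ℚ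
minor M i j k i′ j′ k′ =
  M i i′ * (M j j′ * M k k′ - M j k′ * M k j′)
  - M i j′ * (M j i′ * M k k′ - M j k′ * M k i′)
  + M i k′ * (M j i′ * M k j′ - M j j′ * M k i′)

minor-cong : ∀ {m n} {M N : Matrix m n} → (∀ i j → M i j ≡ N i j) →
  ∀ i j k i′ j′ k′ → minor M i j k i′ j′ k′ ≡ minor N i j k i′ j′ k′
minor-cong eq i j k i′ j′ k′
  rewrite eq i i′ | eq i j′ | eq i k′ | eq j i′ | eq j j′ | eq j k′ | eq k i′ | eq k j′ | eq k k′
  = refl

-- All columns are combinations of two vectors, so each 3 × 3 submatrix is a 3 × 2 matrix times a 2
-- × 3 matrix. Its determinant is zero as a polynomial in the twelve entries of the two factors.
rank2⇒minor≡0 : ∀ {m n} {M : Matrix m n} → HasRank M 2 →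
  ∀ i j k i′ j′ k′ → minor M i j k i′ j′ k′ ≡ 0ℚ
rank2⇒minor≡0 {M = M} (b , _ , span) i j k i′ j′ k′ =
  trans (minor-cong (λ i j → proj₂ (column j) i) i j k i′ j′ k′)
    (identity (x i) (x j) (x k) (z i) (z j) (z k)
              (y i′) (y j′) (y k′) (w i′) (w j′) (w k′))
  where
  column : ∀ j → InSpan b (transpose M j)
  column j = Equivalence.to (span (transpose M j)) (generator∈span (transpose M) j)
  x = b zero
  z = b (suc zero)
  y = λ j → proj₁ (column j) zero
  w = λ j → proj₁ (column j) (suc zero)
  -- `m` is `linearCombination` of two vectors unfolded at one coordinate. The final `0ℚ` is the
  -- empty sum, kept so that the two sides match definitionally.
  identity : ∀ x₁ x₂ x₃ z₁ z₂ z₃ y₁ y₂ y₃ w₁ w₂ w₃ →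
    let m : ℚ → ℚ → ℚ → ℚ → ℚ
        m = λ x z y w → y * x + (w * z + 0ℚ) in
    m x₁ z₁ y₁ w₁ * (m x₂ z₂ y₂ w₂ * m x₃ z₃ y₃ w₃ - m x₂ z₂ y₃ w₃ * m x₃ z₃ y₂ w₂)
    - m x₁ z₁ y₂ w₂ * (m x₂ z₂ y₁ w₁ * m x₃ z₃ y₃ w₃ - m x₂ z₂ y₃ w₃ * m x₃ z₃ y₁ w₁)
    + m x₁ z₁ y₃ w₃ * (m x₂ z₂ y₁ w₁ * m x₃ z₃ y₂ w₂ - m x₂ z₂ y₂ w₂ * m x₃ z₃ y₁ w₁) ≡ 0ℚ
  identity = solve 12 (λ x₁ x₂ x₃ z₁ z₂ z₃ y₁ y₂ y₃ w₁ w₂ w₃ →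
    let m = λ x z y w → y :* x :+ (w :* z :+ con 0ℚ) in
    m x₁ z₁ y₁ w₁ :* (m x₂ z₂ y₂ w₂ :* m x₃ z₃ y₃ w₃ :- m x₂ z₂ y₃ w₃ :* m x₃ z₃ y₂ w₂)
    :- m x₁ z₁ y₂ w₂ :* (m x₂ z₂ y₁ w₁ :* m x₃ z₃ y₃ w₃ :- m x₂ z₂ y₃ w₃ :* m x₃ z₃ y₁ w₁)
    :+ m x₁ z₁ y₃ w₃ :* (m x₂ z₂ y₁ w₁ :* m x₃ z₃ y₂ w₂ :- m x₂ z₂ y₂ w₂ :* m x₃ z₃ y₁ w₁)
    := con 0ℚ) refl

-- Pfaffians of skew-symmetric matrices

module SkewMatrix {n} (s : Matrix n n) (skew : ∀ u v → s u v ≡ - s v u) where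

  pfaffian : (a b c d : Fin n) → ℚ
  pfaffian a b c d = s a b * s c d - s a c * s b d + s a d * s b c

  -- Deleting row `d` and column `c` from the 4 × 4 principal submatrix leaves this minor. Up to
  -- sign, such a cofactor of a skew-symmetric matrix is the Pfaffian of the whole times the
  -- Pfaffian on the two remaining indices, here `s a b`.
  minor≡entry*pfaffian : (∀ u → s u u ≡ 0ℚ) → ∀ a b c d →
    minor s a b c a b d ≡ s a b * pfaffian a b c d
  minor≡entry*pfaffian diagonal a b c d
    rewrite diagonal a | diagonal b | skew b a | skew c a | skew c b =
    solve 6 (λ ab ac ad bc bd cd →
      con 0ℚ :* (con 0ℚ :* cd :- bd :* (:- bc))
      :- ab :* ((:- ab) :* cd :- bd :* (:- ac))
      :+ ad :* ((:- ab) :* (:- bc) :- con 0ℚ :* (:- ac))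
      := ab :* (ab :* cd :- ac :* bd :+ ad :* bc)) refl
      (s a b) (s a c) (s a d) (s b c) (s b d) (s c d)

  -- The Pfaffian is alternating. The exchanges of neighbouring indices, here and in the next two
  -- lemmas, generate all permutations, so its vanishing can be checked in any order of the indices.
  swap₁₂ : ∀ a b c d → pfaffian b a c d ≡ 0ℚ → pfaffian a b c d ≡ 0ℚ
  swap₁₂ a b c d eq = begin
    pfaffian a b c d    ≡⟨ cong (λ ab → ab * s c d - s a c * s b d + s a d * s b c) (skew a b) ⟩
    (- s b a) * s c d - s a c * s b d + s a d * s b c
      ≡⟨ solve 6 (λ ba ac ad bc bd cd → (:- ba) :* cd :- ac :* bd :+ ad :* bc
           := :- (ba :* cd :- bc :* ad :+ bd :* ac)) refl
           (s b a) (s a c) (s a d) (s b c) (s b d) (s c d) ⟩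
    - pfaffian b a c d  ≡⟨ cong -_ eq ⟩
    0ℚ                  ∎

  swap₂₃ : ∀ a b c d → pfaffian a c b d ≡ 0ℚ → pfaffian a b c d ≡ 0ℚ
  swap₂₃ a b c d eq = begin
    pfaffian a b c d    ≡⟨ cong (λ bc → s a b * s c d - s a c * s b d + s a d * bc) (skew b c) ⟩
    s a b * s c d - s a c * s b d + s a d * (- s c b)
      ≡⟨ solve 6 (λ ab ac ad cb bd cd → ab :* cd :- ac :* bd :+ ad :* (:- cb)
           := :- (ac :* bd :- ab :* cd :+ ad :* cb)) refl
           (s a b) (s a c) (s a d) (s c b) (s b d) (s c d) ⟩
    - pfaffian a c b d  ≡⟨ cong -_ eq ⟩
    0ℚ                  ∎

  swap₃₄ : ∀ a b c d → pfaffian a b d c ≡ 0ℚ → pfaffian a b c d ≡ 0ℚ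
  swap₃₄ a b c d eq = begin
    pfaffian a b c d    ≡⟨ cong (λ cd → s a b * cd - s a c * s b d + s a d * s b c) (skew c d) ⟩
    s a b * (- s d c) - s a c * s b d + s a d * s b c
      ≡⟨ solve 6 (λ ab ac ad bc bd dc → ab :* (:- dc) :- ac :* bd :+ ad :* bc
           := :- (ab :* dc :- ad :* bc :+ ac :* bd)) refl
           (s a b) (s a c) (s a d) (s b c) (s b d) (s d c) ⟩
    - pfaffian a b d c  ≡⟨ cong -_ eq ⟩
    0ℚ                  ∎

  rank2 : (∀ u → s u u ≡ 0ℚ) → ∀ u v → IsSign (s u v) →
    (∀ k l → pfaffian u v k l ≡ 0ℚ) → HasRank s 2
  rank2 diagonal u v ±uv pf≡0 = b , independent , λ x → mk⇔ (span-mono {b = b} to) (span-mono {a = b} from)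
    where
    b : Vector (Vector ℚ n) 2
    b = transpose s u Vector.∷ transpose s v Vector.∷ Vector.[]

    -- Row `v` of a combination isolates the first coefficient and row `u` the second, because the
    -- zero diagonal removes the other one.
    independent : LinearlyIndependent b
    independent c c·b≗0 zero = sign-cancelˡ ±uv (c zero) (begin
      s u v * c zero
        ≡⟨ solve 3 (λ uv x y → uv :* x := :- (x :* (:- uv) :+ (y :* con 0ℚ :+ con 0ℚ))) refl
             (s u v) (c zero) (c (suc zero)) ⟩
      - (c zero * (- s u v) + (c (suc zero) * 0ℚ + 0ℚ))
        ≡⟨ cong -_ (cong₂ (λ vu vv → c zero * vu + (c (suc zero) * vv + 0ℚ))
             (sym (skew v u)) (sym (diagonal v))) ⟩
      - linearCombination c b v
        ≡⟨ cong -_ (c·b≗0 v) ⟩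
      0ℚ ∎)
    independent c c·b≗0 (suc zero) = sign-cancelˡ ±uv (c (suc zero)) (begin
      s u v * c (suc zero)
        ≡⟨ solve 3 (λ uv x y → uv :* y := x :* con 0ℚ :+ (y :* uv :+ con 0ℚ)) refl
             (s u v) (c zero) (c (suc zero)) ⟩
      c zero * 0ℚ + (c (suc zero) * s u v + 0ℚ)
        ≡⟨ cong (λ uu → c zero * uu + (c (suc zero) * s u v + 0ℚ)) (sym (diagonal u)) ⟩
      linearCombination c b u
        ≡⟨ c·b≗0 u ⟩
      0ℚ ∎)

    to : ∀ l → InSpan b (transpose s l)
    -- The coefficients come from solving `pfaffian u v k l ≡ 0ℚ` for `s k l`, with `s u v` its own
    -- inverse; they do not depend on the row `k`.
    to l = (- (s u v * s v l) Vector.∷ s u v * s u l Vector.∷ Vector.[]) , λ k → sym (begin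
      - (s u v * s v l) * s k u + (s u v * s u l * s k v + 0ℚ)
        ≡⟨ cong₂ (λ ku kv → - (s u v * s v l) * ku + (s u v * s u l * kv + 0ℚ))
             (skew k u) (skew k v) ⟩
      - (s u v * s v l) * (- s u k) + (s u v * s u l * (- s v k) + 0ℚ)
        ≡⟨ solve 6 (λ uv uk ul vk vl kl →
             :- (uv :* vl) :* (:- uk) :+ (uv :* ul :* (:- vk) :+ con 0ℚ)
             := uv :* uv :* kl :- uv :* (uv :* kl :- uk :* vl :+ ul :* vk)) refl
             (s u v) (s u k) (s u l) (s v k) (s v l) (s k l) ⟩
      s u v * s u v * s k l - s u v * pfaffian u v k l
        ≡⟨ cong₂ (λ p q → p * s k l - s u v * q) (sign-square ±uv) (pf≡0 k l) ⟩
      1ℚ * s k l - s u v * 0ℚ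
        ≡⟨ solve 2 (λ uv kl → con 1ℚ :* kl :- uv :* con 0ℚ := kl) refl (s u v) (s k l) ⟩
      s k l ∎)

    from : ∀ j → InSpan (transpose s) (b j)
    from zero       = generator∈span (transpose s) u
    from (suc zero) = generator∈span (transpose s) v

-- Complete multipartite structure and neighbours

module _ {n} (G : SimpleGraph n) where
  open SimpleGraph G using (Adj; adj?) renaming (sym to adj-sym)

  -- The parts are the classes of non-adjacency, and `r` picks one representative of each. A vertex
  -- is put in the part of a representative to which it is not adjacent.
  completeMultipartite : ∀ {k} (r : Fin k → Fin n) →
    (∀ {u v w} → ¬ Adj u v → ¬ Adj v w → ¬ Adj u w) →
    (∀ {i j} → i ≢ j → Adj (r i) (r j)) →
    (∀ u → ∃[ i ] ¬ Adj u (r i)) →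
    CompleteMultipartite G k
  completeMultipartite r nonadj-trans r-adj cover =
    part , (λ i → r i , λ { refl → part-r i }) , λ u v → mk⇔ (to u v) (from u v)
    where
    part = λ u → proj₁ (cover u)
    nonadj = λ u → proj₂ (cover u)

    part-r : ∀ i → part (r i) ≡ i
    -- Were `r i` put in another part, it would be adjacent to the representative of that part,
    -- against the choice made by `cover`.
    part-r i = decidable-stable (part (r i) ≟ i) λ p≢i → nonadj (r i) (r-adj (p≢i ∘ sym))

    to : ∀ u v → Adj u v → part u ≢ part v
    to u v uv eq = nonadj-trans (nonadj u)
      (λ rv → nonadj v (adj-sym (subst (λ i → Adj (r i) v) eq rv))) uv

    from : ∀ u v → part u ≢ part v → Adj u v
    -- If `u` and `v` were not adjacent, the chain from `r (part u)` through `u` and `v` to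
    -- `r (part v)` would make two distinct representatives non-adjacent.
    from u v p≢q = decidable-stable (adj? u v) λ ¬uv →
      nonadj-trans (λ ru → nonadj u (adj-sym ru)) (nonadj-trans ¬uv (nonadj v)) (r-adj p≢q)

-- A path from `u` to some other vertex, here `punchIn u zero`, is not empty, and its first edge
-- ends in a neighbour.
connected⇒neighbour : ∀ {n} (G : SimpleGraph n) → n ≥ 2 → Connected G →
  ∀ u → ∃[ v ] SimpleGraph.Adj G u v
connected⇒neighbour G (s≤s (s≤s _)) connected u
  with punchIn u zero | punchInᵢ≢i u zero | connected u (punchIn u zero)
... | _ | v≢u | ε      = contradiction refl v≢u
... | _ | _   | uw ◅ _ = _ , uw

-- Entries of the skew-adjacency matrix

module _ {n} (G : OrientedGraph n) where
  open OrientedGraph G using (Adj; adj?; arc?; arc⇒adj; adj⇒arc; asym; irrefl)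
    renaming (sym to adj-sym)

  private
    s = skewAdjacency G

  skewAdjacency-skew : ∀ u v → s u v ≡ - s v u
  skewAdjacency-skew u v with arc? u v | arc? v u
  ... | yes uv | yes vu = contradiction vu (asym uv)
  ... | yes _  | no _   = refl
  ... | no _   | yes _  = refl
  ... | no _   | no _   = refl

  adj⇒sign : ∀ {u v} → Adj u v → IsSign (s u v)
  adj⇒sign {u} {v} uv with arc? u v | arc? v u
  ... | yes _ | _     = inj₁ refl
  ... | no _  | yes _ = inj₂ refl
  ... | no ¬a | no ¬b = contradiction (adj⇒arc uv) [ ¬a , ¬b ]′

  nonadj⇒0 : ∀ {u v} → ¬ Adj u v → s u v ≡ 0ℚ
  nonadj⇒0 {u} {v} ¬uv with arc? u v | arc? v u
  ... | yes a | _     = contradiction (arc⇒adj a) ¬uv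
  ... | no _  | yes b = contradiction (adj-sym (arc⇒adj b)) ¬uv
  ... | no _  | no _  = refl

  skewAdjacency-diagonal : ∀ u → s u u ≡ 0ℚ
  skewAdjacency-diagonal u = nonadj⇒0 (irrefl refl)

  open SkewMatrix s skewAdjacency-skew

  -- Graph structure forced by vanishing Pfaffians

  module PfaffiansVanish
    (pf≡0 : ∀ {a b} → Adj a b → ∀ c d → pfaffian a b c d ≡ 0ℚ)
    (neighbour : ∀ u → ∃[ v ] Adj u v) where

    -- Suppose `u` and `w` are adjacent and let `x` be a neighbour of `v`. In `pfaffian u w v x` the
    -- last two products contain `s u v` or `s w v` and vanish, while the first is a product of two
    -- signs, so the Pfaffian is not zero.
    nonadj-trans : ∀ {u v w} → ¬ Adj u v → ¬ Adj v w → ¬ Adj u w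
    nonadj-trans {u} {v} {w} ¬uv ¬vw uw with neighbour v
    ... | x , vx = sign≢0 (sign-* (adj⇒sign uw) (adj⇒sign vx)) (begin
      s u w * s v x
        ≡⟨ solve 3 (λ p q r → p := p :- con 0ℚ :* q :+ r :* con 0ℚ) refl
             (s u w * s v x) (s w x) (s u x) ⟩
      s u w * s v x - 0ℚ * s w x + s u x * 0ℚ
        ≡⟨ cong₂ (λ uv wv → s u w * s v x - uv * s w x + s u x * wv)
             (sym (nonadj⇒0 ¬uv)) (sym (nonadj⇒0 (¬vw ∘ adj-sym))) ⟩
      pfaffian u w v x
        ≡⟨ pf≡0 uw v x ⟩
      0ℚ ∎)

    no-K₄ : ∀ {a b c d} → Adj a b → Adj a c → Adj a d → Adj b c → Adj b d → ¬ Adj c d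
    no-K₄ {c = c} {d} ab ac ad bc bd cd = sum-of-three-signs≢0
      (sign-* (adj⇒sign ab) (adj⇒sign cd))
      (sign-* (adj⇒sign ac) (adj⇒sign bd))
      (sign-* (adj⇒sign ad) (adj⇒sign bc)) (pf≡0 ab c d)

    -- Whether a chosen edge `u v` lies in a triangle decides the number of parts. If not, no vertex
    -- is adjacent to both ends, so these represent two parts; if so, the corners of the triangle
    -- represent three.
    bipartite⊎tripartite : Fin n → CompleteBipartite (underlying G) ⊎ CompleteTripartite (underlying G)
    bipartite⊎tripartite u with neighbour u
    ... | v , uv with any? (λ w → adj? u w ×-dec adj? v w)
    ... | no ¬w = inj₁ (completeMultipartite (underlying G) (lookup (u ∷ v ∷ []))
          nonadj-trans r-adj cover)
      where
      r-adj : ∀ {i j} → i ≢ j → Adj (lookup (u ∷ v ∷ []) i) (lookup (u ∷ v ∷ []) j)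
      r-adj {zero}     {zero}     i≢j = contradiction refl i≢j
      r-adj {zero}     {suc zero} i≢j = uv
      r-adj {suc zero} {zero}     i≢j = adj-sym uv
      r-adj {suc zero} {suc zero} i≢j = contradiction refl i≢j
      cover : ∀ x → ∃[ i ] ¬ Adj x (lookup (u ∷ v ∷ []) i)
      cover x with adj? x u
      ... | no ¬xu = zero , ¬xu
      ... | yes xu = suc zero , λ xv → ¬w (x , adj-sym xu , adj-sym xv)
    ... | yes (w , uw , vw) = inj₂ (completeMultipartite (underlying G) (lookup (u ∷ v ∷ w ∷ []))
          nonadj-trans r-adj cover)
      where
      r-adj : ∀ {i j} → i ≢ j → Adj (lookup (u ∷ v ∷ w ∷ []) i) (lookup (u ∷ v ∷ w ∷ []) j)
      r-adj {zero}           {zero}           i≢j = contradiction refl i≢j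
      r-adj {zero}           {suc zero}       i≢j = uv
      r-adj {zero}           {suc (suc zero)} i≢j = uw
      r-adj {suc zero}       {zero}           i≢j = adj-sym uv
      r-adj {suc zero}       {suc zero}       i≢j = contradiction refl i≢j
      r-adj {suc zero}       {suc (suc zero)} i≢j = vw
      r-adj {suc (suc zero)} {zero}           i≢j = adj-sym uw
      r-adj {suc (suc zero)} {suc zero}       i≢j = adj-sym vw
      r-adj {suc (suc zero)} {suc (suc zero)} i≢j = contradiction refl i≢j
      cover : ∀ x → ∃[ i ] ¬ Adj x (lookup (u ∷ v ∷ w ∷ []) i)
      cover x with adj? x u | adj? x v
      ... | no ¬xu | _      = zero , ¬xu
      ... | yes _  | no ¬xv = suc zero , ¬xv
      -- A vertex `x` adjacent to all three corners would complete the triangle to a K₄.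
      ... | yes xu | yes xv = suc (suc zero) , no-K₄ uv (adj-sym xu) uw (adj-sym xv) vw

    evenlyOriented : (C : Cycle (underlying G) 4) → EvenlyOriented G C
    evenlyOriented C = subst (0ℚ <_) (sym product≡1) (toWitness {a? = 0ℚ <? 1ℚ} _)
      where
      open Cycle C
      a = vertex zero
      b = vertex (suc zero)
      c = vertex (suc (suc zero))
      d = vertex (suc (suc (suc zero)))
      ab = adjacent zero
      bc = adjacent (suc zero)
      cd = adjacent (suc (suc zero))
      da = adjacent (suc (suc (suc zero)))

      -- If both chords of the 4-cycle were edges, its vertices would form a K₄.
      diagonals : s a c * s b d ≡ 0ℚ
      diagonals with adj? a c | adj? b d
      ... | no ¬ac | _      = trans (cong (_* s b d) (nonadj⇒0 ¬ac)) (*-zeroˡ (s b d))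
      ... | yes _  | no ¬bd = trans (cong (s a c *_) (nonadj⇒0 ¬bd)) (*-zeroʳ (s a c))
      ... | yes ac | yes bd = contradiction cd (no-K₄ ab ac (adj-sym da) bc bd)

      product≡1 : s a b * (s b c * (s c d * (s d a * 1ℚ))) ≡ 1ℚ
      -- Let t be `s a b * s c d`. Since `diagonals` removes the middle term of the Pfaffian, the
      -- product around the cycle is t² minus t times the Pfaffian, which is 1.
      product≡1 = begin
        s a b * (s b c * (s c d * (s d a * 1ℚ)))
          ≡⟨ solve 4 (λ ab bc cd da → ab :* (bc :* (cd :* (da :* con 1ℚ)))
               := (ab :* cd) :* (ab :* cd)
                  :- (ab :* cd) :* (ab :* cd :- con 0ℚ :+ (:- da) :* bc)) refl
               (s a b) (s b c) (s c d) (s d a) ⟩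
        (s a b * s c d) * (s a b * s c d) - (s a b * s c d) * (s a b * s c d - 0ℚ + (- s d a) * s b c)
          ≡⟨ cong₂ (λ x y → (s a b * s c d) * (s a b * s c d)
                     - (s a b * s c d) * (s a b * s c d - x + y * s b c))
               (sym diagonals) (sym (skewAdjacency-skew a d)) ⟩
        (s a b * s c d) * (s a b * s c d) - (s a b * s c d) * pfaffian a b c d
          ≡⟨ cong₂ (λ x y → x - (s a b * s c d) * y)
               (sign-square (sign-* (adj⇒sign ab) (adj⇒sign cd))) (pf≡0 ab c d) ⟩
        1ℚ - (s a b * s c d) * 0ℚ
          ≡⟨ cong (λ x → 1ℚ - x) (*-zeroʳ (s a b * s c d)) ⟩
        1ℚ ∎

  rank2⇒pfaffian≡0 : HasSkewRank G 2 → ∀ {a b} → Adj a b → ∀ c d → pfaffian a b c d ≡ 0ℚ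
  rank2⇒pfaffian≡0 rank {a} {b} ab c d = sign-cancelˡ (adj⇒sign ab) (pfaffian a b c d)
    (trans (sym (minor≡entry*pfaffian skewAdjacency-diagonal a b c d))
           (rank2⇒minor≡0 rank a b c a b d))

  -- Vanishing Pfaffians from even 4-cycles

  module EvenMultipartite {k} (complete : CompleteMultipartite (underlying G) k)
    (even : (C : Cycle (underlying G) 4) → EvenlyOriented G C) where

    private
      part = proj₁ complete
      module P u v = Equivalence (proj₂ (proj₂ complete) u v)

    same-part⇒0 : ∀ {u v} → part u ≡ part v → s u v ≡ 0ℚ
    same-part⇒0 eq = nonadj⇒0 λ uv → P.to _ _ uv eq

    -- Coinciding rows or columns are trivial, and if `u` or `v` shares the part of `x` and `y`,
    -- both sides contain a zero. Otherwise `u x v y` is a 4-cycle, and its evenness says that the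
    -- two sides, both signs, have positive product.
    same-part⇒proportional : ∀ u v {x y} → part x ≡ part y → s u x * s v y ≡ s u y * s v x
    same-part⇒proportional u v {x} {y} x~y with x ≟ y | u ≟ v | part u ≟ part x | part v ≟ part x
    ... | yes refl | _        | _       | _       = refl
    ... | no _     | yes refl | _       | _       = *-comm (s u x) (s u y)
    ... | no _     | no _     | yes u~x | _
      rewrite same-part⇒0 u~x | same-part⇒0 (trans u~x x~y)
      = trans (*-zeroˡ (s v y)) (sym (*-zeroˡ (s v x)))
    ... | no _     | no _     | no _    | yes v~x
      rewrite same-part⇒0 v~x | same-part⇒0 (trans v~x x~y)
      = trans (*-zeroʳ (s u x)) (sym (*-zeroʳ (s u y)))
    ... | no x≢y   | no u≢v   | no u≁x  | no v≁x  =
      signs-agree (sign-* (adj⇒sign ux) (adj⇒sign vy)) (sign-* (adj⇒sign uy) (adj⇒sign vx))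
        (subst (0ℚ <_) product (even C))
      where
      ux = P.from u x u≁x
      vx = P.from v x v≁x
      uy = P.from u y (u≁x ∘ λ u~y → trans u~y (sym x~y))
      vy = P.from v y (v≁x ∘ λ v~y → trans v~y (sym x~y))

      adj⇒≢ : ∀ {a b} → Adj a b → a ≢ b
      adj⇒≢ ab refl = irrefl refl ab

      vertices = u ∷ x ∷ v ∷ y ∷ []

      adjacent : ∀ i → Adj (lookup vertices i) (lookup vertices (next i))
      adjacent zero                   = ux
      adjacent (suc zero)             = adj-sym vx
      adjacent (suc (suc zero))       = vy
      adjacent (suc (suc (suc zero))) = adj-sym uy

      C : Cycle (underlying G) 4
      C = record
        { 3≤k       = s≤s (s≤s (s≤s z≤n))
        ; vertex    = lookup vertices
        ; injective = lookup-injective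
            ((adj⇒≢ ux ∷ u≢v ∷ adj⇒≢ uy ∷ []) ∷ (adj⇒≢ (adj-sym vx) ∷ x≢y ∷ []) ∷
             (adj⇒≢ vy ∷ []) ∷ [] ∷ []) _ _
        ; adjacent  = adjacent
        }

      product : s u x * (s x v * (s v y * (s y u * 1ℚ))) ≡ (s u x * s v y) * (s u y * s v x)
      product = begin
        s u x * (s x v * (s v y * (s y u * 1ℚ)))
          -- The cycle runs through two of its edges from column to row; the two changes of sign
          -- cancel.
          ≡⟨ cong₂ (λ xv yu → s u x * (xv * (s v y * (yu * 1ℚ))))
               (skewAdjacency-skew x v) (skewAdjacency-skew y u) ⟩
        s u x * ((- s v x) * (s v y * ((- s u y) * 1ℚ)))
          ≡⟨ solve 4 (λ ux vx vy uy → ux :* ((:- vx) :* (vy :* ((:- uy) :* con 1ℚ)))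
               := (ux :* vy) :* (uy :* vx)) refl (s u x) (s v x) (s v y) (s u y) ⟩
        (s u x * s v y) * (s u y * s v x) ∎

    -- The first product contains `s c d`, which is zero; the other two form, up to sign, the 2 × 2
    -- minor on rows `a`, `b` and columns `c`, `d`.
    same-part⇒pfaffian≡0 : ∀ a b {c d} → part c ≡ part d → pfaffian a b c d ≡ 0ℚ
    same-part⇒pfaffian≡0 a b {c} {d} c~d = begin
      pfaffian a b c d
        ≡⟨ cong₂ (λ cd q → s a b * cd - q + s a d * s b c)
             (same-part⇒0 c~d) (same-part⇒proportional a b c~d) ⟩
      s a b * 0ℚ - s a d * s b c + s a d * s b c
        ≡⟨ solve 2 (λ ab q → ab :* con 0ℚ :- q :+ q := con 0ℚ) refl (s a b) (s a d * s b c) ⟩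
      0ℚ ∎

    pfaffian≡0 : k ℕ.< 4 → ∀ a b c d → pfaffian a b c d ≡ 0ℚ
    pfaffian≡0 k<4 a b c d with pigeonhole k<4 (part ∘ lookup (a ∷ b ∷ c ∷ d ∷ []))
    -- The pigeonhole principle yields positions i < j in the same part; the first four clauses
    -- dismiss the pairs in the wrong order.
    ... | _ , zero , () , _
    ... | suc _ , suc zero , s<s () , _
    ... | suc (suc _) , suc (suc zero) , s<s (s<s ()) , _
    ... | suc (suc (suc zero)) , suc (suc (suc zero)) , s<s (s<s (s<s ())) , _
    -- Each chain of exchanges moves the two vertices of the common part to the last two places.
    ... | zero , suc zero , _ , a~b =
      swap₂₃ a b c d (swap₁₂ a c b d (swap₃₄ c a b d (swap₂₃ c a d b
        (same-part⇒pfaffian≡0 c d a~b))))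
    ... | zero , suc (suc zero) , _ , a~c =
      swap₁₂ a b c d (swap₃₄ b a c d (swap₂₃ b a d c (same-part⇒pfaffian≡0 b d a~c)))
    ... | zero , suc (suc (suc zero)) , _ , a~d =
      swap₁₂ a b c d (swap₂₃ b a c d (same-part⇒pfaffian≡0 b c a~d))
    ... | suc zero , suc (suc zero) , _ , b~c =
      swap₃₄ a b c d (swap₂₃ a b d c (same-part⇒pfaffian≡0 a d b~c))
    ... | suc zero , suc (suc (suc zero)) , _ , b~d =
      swap₂₃ a b c d (same-part⇒pfaffian≡0 a c b~d)
    ... | suc (suc zero) , suc (suc (suc zero)) , _ , c~d = same-part⇒pfaffian≡0 a b c~d

    skewRank≡2 : k ℕ.< 4 → ∀ {u v} → Adj u v → HasSkewRank G 2
    skewRank≡2 k<4 {u} {v} uv =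
      rank2 skewAdjacency-diagonal u v (adj⇒sign uv) (pfaffian≡0 k<4 u v)

theorem3p3 : ∀ (n : ℕ) → n ≥ 5 → ∀ (G : OrientedGraph n) → Connected (underlying G) →
    HasSkewRank G 2 ⇔
    ((CompleteBipartite (underlying G) ⊎ CompleteTripartite (underlying G)) ×
    (∀ (C : Cycle (underlying G) 4) → EvenlyOriented G C))
theorem3p3 (suc (suc _)) (s≤s (s≤s _)) G connected = mk⇔
  (λ rank → let open PfaffiansVanish G (rank2⇒pfaffian≡0 G rank) neighbour in
    bipartite⊎tripartite zero , evenlyOriented)
  -- An edge at `zero` gives the two basis columns; the inequalities are 2 < 4 and 3 < 4 for the
  -- number of parts.
  (λ { (inj₁ bipartite  , even) → EvenMultipartite.skewRank≡2 G bipartite even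
         (s≤s (s≤s (s≤s z≤n))) (proj₂ (neighbour zero))
     ; (inj₂ tripartite , even) → EvenMultipartite.skewRank≡2 G tripartite even
         (s≤s (s≤s (s≤s (s≤s z≤n)))) (proj₂ (neighbour zero)) })
  where
  neighbour = connected⇒neighbour (underlying G) (s≤s (s≤s z≤n)) connected
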